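{- For every fixed integer $k\ge 2$, \[ \lim_{n\rightarrow\infty} \overline{m}(n,k)\cdot\frac{k(k-1)}{n(n-1)}=1 . \]
   Context: A hypergraph is an ordered pair $(X,H)$ such that $X$ is a set (of vertices) and $H$ is a family of subsets of $X$ (edges, which may have arbitrary sizes). A set $T$ of vertices in a hypergraph is called affinely closed if, and only if, every edge that shares at least two vertices with $T$ is fully contained in $T$. For every set $S$ of vertices, the affine closure $\mathrm{aff}(S)$ is the intersection of all affinely closed supersets of $S$ (it is itself affinely closed). The closure-lines in the hypergraph are all the sets $\mathrm{aff}(\{u,v\})$ with $u$ and $v$ two distinct vertices. For integers $n,k$, $\overline{m}(n,k)$ denotes the smallest number of (distinct) closure-lines in a hypergraph on $n$ vertices where every closure-line consists of at most $k$ vertices. -}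

module Defs where

open import Data.Bool.Properties using () renaming (_≟_ to _≟ᵇ_)
open import Data.Fin.Base using (Fin)
open import Data.Fin.Properties using (any?) renaming (_≟_ to _≟ᶠ_)
open import Data.Fin.Subset
  using (Subset; inside; outside; _⊆_; _∩_; _∪_; ⋂; ⁅_⁆; ∣_∣)
open import Data.Fin.Subset.Properties
  using (_⊆?_; ⊆-refl; ⊆-trans; p∩q⊆p; p∩q⊆q; p⊆q⇒∣p∣≤∣q∣; ∣⁅x⁆∣≡1)
open import Data.List.Base using (List; []; _∷_; _++_; map; filter; length)
open import Data.List.Extrema.Nat using (argmin; argmin-sel; f[argmin]≤f[xs])
open import Data.List.Membership.Propositional using (_∈_)
open import Data.List.Membership.Propositional.Properties
  using (∈-map⁺; ∈-++⁺ˡ; ∈-++⁺ʳ; ∈-filter⁺; ∈-filter⁻)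
open import Data.List.Properties using (filter-≐)
open import Data.List.Relation.Unary.All as All using (All; [])
open import Data.List.Relation.Unary.Any using (here; there)
open import Data.Nat.Base using (ℕ; zero; suc; _+_; _≤_; z≤n; s≤s)
open import Data.Nat.Properties
  using (_≤?_; ≤-trans; ≤-reflexive; +-suc; m≤n⇒m≤1+n; module ≤-Reasoning)
open import Data.Product.Base using (∃; ∃-syntax; _×_; _,_; proj₁; proj₂)
open import Data.Rational.Base as ℚ using (ℚ; 0ℚ)
open import Data.Sum.Base using ([_,_]′)
open import Data.Vec.Base using ([]; _∷_)
open import Data.Vec.Properties using (≡-dec)
open import Relation.Binary.Definitions using (DecidableEquality)
open import Relation.Binary.PropositionalEquality
  using (_≡_; _≢_; refl; sym; trans; cong; cong₂; subst)
open import Relation.Nullary using (yes; no; ¬?)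
open import Relation.Nullary.Decidable using (_×-dec_; _→-dec_; map′)
open import Relation.Unary using (Decidable)

import Data.List.Membership.DecPropositional as DecMembership

private
  variable
    n k : ℕ

infix 4 _≟ˢ_

_≟ˢ_ : DecidableEquality (Subset n)
_≟ˢ_ = ≡-dec _≟ᵇ_

-- Every subset of Fin n, each listed exactly once.

subsets : ∀ n → List (Subset n)
subsets zero    = [] ∷ []
subsets (suc n) = map (inside ∷_) (subsets n) ++ map (outside ∷_) (subsets n)

∈-subsets : (S : Subset n) → S ∈ subsets n
∈-subsets []            = here refl
∈-subsets (inside  ∷ S) = ∈-++⁺ˡ (∈-map⁺ (inside ∷_) (∈-subsets S))
∈-subsets {suc n} (outside ∷ S) =
  ∈-++⁺ʳ (map (inside ∷_) (subsets n)) (∈-map⁺ (outside ∷_) (∈-subsets S))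

-- A hypergraph with vertex set Fin n, given by a list of its edges. Order and
-- repetition in the list have no effect on the notions below.

Hypergraph : ℕ → Set
Hypergraph n = List (Subset n)

AffinelyClosed : Hypergraph n → Subset n → Set
AffinelyClosed H T = All (λ e → 2 ≤ ∣ e ∩ T ∣ → e ⊆ T) H

affinelyClosed? : (H : Hypergraph n) → Decidable (AffinelyClosed H)
affinelyClosed? H T = All.all? (λ e → (2 ≤? ∣ e ∩ T ∣) →-dec (e ⊆? T)) H

ClosedSuperset : Hypergraph n → Subset n → Subset n → Set
ClosedSuperset H S T = S ⊆ T × AffinelyClosed H T

closedSuperset? : (H : Hypergraph n) (S : Subset n) → Decidable (ClosedSuperset H S)
closedSuperset? H S T = (S ⊆? T) ×-dec affinelyClosed? H T

aff : Hypergraph n → Subset n → Subset n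
aff {n} H S = ⋂ (filter (closedSuperset? H S) (subsets n))

IsClosureLine : Hypergraph n → Subset n → Set
IsClosureLine H L = ∃[ u ] ∃[ v ] u ≢ v × L ≡ aff H (⁅ u ⁆ ∪ ⁅ v ⁆)

isClosureLine? : (H : Hypergraph n) → Decidable (IsClosureLine H)
isClosureLine? H L =
  any? λ u → any? λ v → ¬? (u ≟ᶠ v) ×-dec (L ≟ˢ aff H (⁅ u ⁆ ∪ ⁅ v ⁆))

closureLines : Hypergraph n → List (Subset n)
closureLines {n} H = filter (isClosureLine? H) (subsets n)

LinesBoundedBy : ℕ → Hypergraph n → Set
LinesBoundedBy k H = ∀ L → IsClosureLine H L → ∣ L ∣ ≤ k

record IsMinimum (n k m : ℕ) : Set where
  field
    attained   : ∃[ H ] LinesBoundedBy {n} k H × length (closureLines H) ≡ m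
    lowerBound : (H : Hypergraph n) → LinesBoundedBy k H → m ≤ length (closureLines H)

-- The minimum exists when k ≥ 2: the edgeless hypergraph is admissible, and
-- every hypergraph has the same closure-lines as one whose list of edges is a
-- sublist of `subsets n`, so only finitely many need be compared.

private

  sublists : ∀ {A : Set} → List A → List (List A)
  sublists []       = [] ∷ []
  sublists (x ∷ xs) = map (x ∷_) (sublists xs) ++ sublists xs

  filter∈sublists : ∀ {A : Set} {P : A → Set} (P? : Decidable P) xs →
                    filter P? xs ∈ sublists xs
  filter∈sublists P? [] = here refl
  filter∈sublists P? (x ∷ xs) with P? x
  ... | yes _ = ∈-++⁺ˡ (∈-map⁺ (x ∷_) (filter∈sublists P? xs))
  ... | no  _ = ∈-++⁺ʳ (map (x ∷_) (sublists xs)) (filter∈sublists P? xs)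

  ⋂⊆ : {S : Subset n} {Ss : List (Subset n)} → S ∈ Ss → ⋂ Ss ⊆ S
  ⋂⊆ {Ss = S ∷ Ss} (here refl) = p∩q⊆p S (⋂ Ss)
  ⋂⊆ {Ss = S ∷ Ss} (there S∈)  = ⊆-trans (p∩q⊆q S (⋂ Ss)) (⋂⊆ S∈)

  ∣p∪q∣≤∣p∣+∣q∣ : (p q : Subset n) → ∣ p ∪ q ∣ ≤ ∣ p ∣ + ∣ q ∣
  ∣p∪q∣≤∣p∣+∣q∣ []            []            = z≤n
  ∣p∪q∣≤∣p∣+∣q∣ (outside ∷ p) (outside ∷ q) = ∣p∪q∣≤∣p∣+∣q∣ p q
  ∣p∪q∣≤∣p∣+∣q∣ (outside ∷ p) (inside  ∷ q) =
    ≤-trans (s≤s (∣p∪q∣≤∣p∣+∣q∣ p q)) (≤-reflexive (sym (+-suc ∣ p ∣ ∣ q ∣)))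
  ∣p∪q∣≤∣p∣+∣q∣ (inside  ∷ p) (outside ∷ q) = s≤s (∣p∪q∣≤∣p∣+∣q∣ p q)
  ∣p∪q∣≤∣p∣+∣q∣ (inside  ∷ p) (inside  ∷ q) =
    s≤s (≤-trans (m≤n⇒m≤1+n (∣p∪q∣≤∣p∣+∣q∣ p q)) (≤-reflexive (sym (+-suc ∣ p ∣ ∣ q ∣))))

  edgeless-bounded : 2 ≤ k → LinesBoundedBy {n} k []
  edgeless-bounded {k} 2≤k _ (u , v , _ , refl) = begin
    ∣ aff [] uv ∣          ≤⟨ p⊆q⇒∣p∣≤∣q∣ (⋂⊆ uv∈) ⟩
    ∣ uv ∣                 ≤⟨ ∣p∪q∣≤∣p∣+∣q∣ ⁅ u ⁆ ⁅ v ⁆ ⟩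
    ∣ ⁅ u ⁆ ∣ + ∣ ⁅ v ⁆ ∣  ≡⟨ cong₂ _+_ (∣⁅x⁆∣≡1 u) (∣⁅x⁆∣≡1 v) ⟩
    2                      ≤⟨ 2≤k ⟩
    k                      ∎
    where
    open ≤-Reasoning
    uv = ⁅ u ⁆ ∪ ⁅ v ⁆
    uv∈ = ∈-filter⁺ (closedSuperset? [] uv) (∈-subsets uv) (⊆-refl , [])

  linesBoundedBy? : ∀ k → Decidable (LinesBoundedBy {n} k)
  linesBoundedBy? k H = map′
    (λ all L line → All.lookup all (∈-filter⁺ (isClosureLine? H) (∈-subsets L) line))
    (λ bounded → All.tabulate λ L∈ →
      bounded _ (proj₂ (∈-filter⁻ (isClosureLine? H) {xs = subsets _} L∈)))
    (All.all? (λ L → ∣ L ∣ ≤? k) (closureLines H))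

  normalise : Hypergraph n → Hypergraph n
  normalise {n} H = filter (_∈? H) (subsets n)
    where open DecMembership (_≟ˢ_ {n})

  module _ (H : Hypergraph n) where
    open DecMembership (_≟ˢ_ {n})

    closed⁺ : ∀ {T} → AffinelyClosed H T → AffinelyClosed (normalise H) T
    closed⁺ c = All.tabulate λ e∈ →
      All.lookup c (proj₂ (∈-filter⁻ (_∈? H) {xs = subsets n} e∈))

    closed⁻ : ∀ {T} → AffinelyClosed (normalise H) T → AffinelyClosed H T
    closed⁻ c = All.tabulate λ e∈ → All.lookup c (∈-filter⁺ (_∈? H) (∈-subsets _) e∈)

    aff-normalise : ∀ S → aff (normalise H) S ≡ aff H S
    aff-normalise S = cong ⋂ (filter-≐
      (closedSuperset? (normalise H) S) (closedSuperset? H S)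
      ((λ (S⊆ , c) → S⊆ , closed⁻ c) , (λ (S⊆ , c) → S⊆ , closed⁺ c))
      (subsets n))

    line⁻ : ∀ {L} → IsClosureLine (normalise H) L → IsClosureLine H L
    line⁻ (u , v , u≢v , eq) = u , v , u≢v , trans eq (aff-normalise _)

    line⁺ : ∀ {L} → IsClosureLine H L → IsClosureLine (normalise H) L
    line⁺ (u , v , u≢v , eq) = u , v , u≢v , trans eq (sym (aff-normalise _))

    closureLines-normalise : closureLines (normalise H) ≡ closureLines H
    closureLines-normalise =
      filter-≐ (isClosureLine? (normalise H)) (isClosureLine? H) (line⁻ , line⁺) (subsets n)

opaque

  minimum : ∀ n {k} → 2 ≤ k → ∃ (IsMinimum n k)
  minimum n {k} 2≤k = numLines best , record
    { attained   = best , best-bounded , refl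
    ; lowerBound = λ H bounded →
        subst (numLines best ≤_) (cong length (closureLines-normalise H))
          (All.lookup (f[argmin]≤f[xs] {f = numLines} [] candidates)
            (∈-filter⁺ (linesBoundedBy? k) (filter∈sublists _ (subsets n))
              (λ L line → bounded L (line⁻ H line))))
    }
    where
    numLines : Hypergraph n → ℕ
    numLines H = length (closureLines H)

    candidates : List (Hypergraph n)
    candidates = filter (linesBoundedBy? k) (sublists (subsets n))

    best : Hypergraph n
    best = argmin numLines [] candidates

    best-bounded : LinesBoundedBy k best
    best-bounded = [ (λ eq → subst (LinesBoundedBy k) (sym eq) (edgeless-bounded 2≤k))
                   , (λ best∈ → proj₂ (∈-filter⁻ (linesBoundedBy? k) {xs = sublists (subsets n)} best∈))
                   ]′ (argmin-sel numLines [] candidates)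

m̅ : ∀ n k → 2 ≤ k → ℕ
m̅ n k 2≤k = proj₁ (minimum n 2≤k)

-- Quantifying over rational ε is equivalent to quantifying over real ε.

infix 4 _⟶_

_⟶_ : (ℕ → ℚ) → ℚ → Set
a ⟶ ℓ = ∀ ε → 0ℚ ℚ.< ε → ∃[ N ] ∀ i → N ≤ i → ℚ.∣ a i ℚ.- ℓ ∣ ℚ.< ε

module Submission where

-- Every pair of points lies in a line, and a line holds at most k(k−1)/2 pairs,
-- so there are at least n(n−1)/(k(k−1)) lines. Conversely the blocks of a linear
-- space with block sizes at most k are its closure-lines. If q ≡ 1 modulo k!,
-- the q² lines j ↦ a + c j over ℤ/q, for j < k, join all pairs in different
-- groups of k groups of q points, each exactly once; spaces on the groups are
-- then filled in recursively, and n is rounded up to a multiple kq, since a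
-- linear space restricts to subsets. No prime q is needed, so consecutive
-- choices of q are a bounded distance apart. After d rounds the proportion of
-- pairs not joined by such blocks of size k is at most 2⁻ᵈ + O(1/n).

open import Defs

module LinearSpaces where

  open import Data.Empty using (⊥)
  open import Data.Fin.Base
    using (Fin; zero; suc; toℕ; fromℕ<; inject≤; combine; remQuot; punchIn; punchOut)
  open import Data.Fin.Properties
    using (toℕ-injective; toℕ<n; toℕ-fromℕ<; fromℕ<-injective; inject≤-injective; suc-injective;
           combine-injective; combine-remQuot; punchIn-injective; punchInᵢ≢i; punchOut-injective;
           injective⇒≤; any?; *↔×; +↔⊎)
    renaming (_≟_ to _≟ᶠ_)
  open import Data.Fin.Subset
    using (Subset; inside; outside; _∈_; _⊆_; _∩_; _∪_; _-_; ⋂; ⁅_⁆; ∣_∣)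
  open import Data.Fin.Subset.Properties
    using (∈⊤; x∈⁅x⁆; x∈⁅y⁆⇒x≡y; x∈p∩q⁺; x∈p∩q⁻; x∈p∪q⁺; x∈p∪q⁻; ⊆-antisym;
           x∈p∧x≢y⇒x∈p-y; x∈p⇒∣p-x∣<∣p∣)
  open import Data.Integer.Base as ℤ using (+_; +<+)
  import Data.Integer.Properties as ℤ
  open import Data.List.Base as List using (List; []; _∷_; length; lookup)
  open import Data.List.Membership.Propositional using () renaming (_∈_ to _∈ˡ_)
  open import Data.List.Membership.Propositional.Properties
    using (∈-filter⁺; ∈-filter⁻; ∈-tabulate⁺; ∈-lookup; ∈-map⁻)
  open import Data.List.Properties using (length-tabulate)
  open import Data.List.Relation.Unary.All as All using (All; []; _∷_)
  open import Data.List.Relation.Unary.All.Properties using (tabulate⁺)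
  open import Data.List.Relation.Unary.AllPairs using ([]; _∷_)
  open import Data.List.Relation.Unary.Any using (index)
  open import Data.List.Relation.Unary.Any.Properties using (lookup-index)
  open import Data.List.Relation.Unary.Unique.Propositional using (Unique)
  import Data.List.Relation.Unary.Unique.Propositional.Properties as Unique
  open import Data.Nat.Base
    using (ℕ; zero; suc; pred; _+_; _*_; _∸_; _^_; _!; _≤_; _<_; z≤n; s≤s; NonZero)
  open import Data.Nat.DivMod
    using (_%_; _/_; _mod_; %-distribˡ-+; %-distribˡ-*; [m+kn]%n≡m%n; m<n⇒m%n≡m; m%n<n;
           m≡m%n+[m/n]*n; m/n*n≤m)
  open import Data.Nat.Divisibility using (_∣_; divides; m∣m*n; ∣-trans; m≤n⇒m!∣n!)
  open import Data.Nat.Properties hiding (suc-injective)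
  open import Data.Nat.Tactic.RingSolver using (solve-∀)
  open import Data.Product.Base using (∃-syntax; _×_; _,_; proj₁; proj₂)
  import Data.Rational.Base as ℚ
  import Data.Rational.Properties as ℚ
  import Data.Rational.Unnormalised.Base as ℚᵘ
  import Data.Rational.Unnormalised.Properties as ℚᵘ
  open import Data.Sum.Base using (_⊎_; inj₁; inj₂; [_,_]′)
  open import Data.Sum.Function.Propositional using (_⊎-↔_)
  open import Data.Vec.Base as Vec using ([]; _∷_; here; there)
  open import Data.Vec.Properties
    using (lookup∘tabulate; lookup⇒[]=; []=⇒lookup; ∷-injectiveʳ)
  open import Function.Base using (_∘_; id)
  open import Function.Bundles using (_↔_; Inverse)
  open import Function.Construct.Composition using (_↔-∘_)
  open import Function.Definitions using (Injective)
  open import Relation.Binary.Definitions using (tri<; tri≈; tri>)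
  open import Relation.Binary.PropositionalEquality
  open import Relation.Nullary using (Dec; yes; no; contradiction; does)
  open import Relation.Nullary.Decidable using (_×-dec_; _⊎-dec_; dec-true)

  private
    variable
      m : ℕ

  -- Linear spaces with blocks of at most k points

  -- `slot` bounds block sizes by k without cardinalities: it is injective on each block and
  -- arbitrary off it. Blocks may repeat or have fewer than two points, so the structure survives
  -- restriction to a subset of the points.
  record LinearSpace (k : ℕ) (P B : Set) : Set₁ where
    infix 4 _on_ _on?_
    field
      _on_   : P → B → Set
      _on?_  : ∀ p b → Dec (p on b)
      slot   : P → B → Fin k
      slot-injective : ∀ {u v b} → u on b → v on b → slot u b ≡ slot v b → u ≡ v
      join   : ∀ {u v} → u ≢ v → ∃[ b ] u on b × v on b
      unique : ∀ {u v w b b′} → u ≢ v → u on b → v on b → u on b′ → v on b′ →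
               w on b → w on b′

  relabel : ∀ {k P P′ B B′} (f : P′ → P) → Injective _≡_ _≡_ f → B′ ↔ B →
            LinearSpace k P B → LinearSpace k P′ B′
  relabel f f-injective B′↔B S = record
    { _on_           = λ p b → f p on to b
    ; _on?_          = λ p b → f p on? to b
    ; slot           = λ p b → slot (f p) (to b)
    ; slot-injective = λ u∈ v∈ eq → f-injective (slot-injective u∈ v∈ eq)
    ; join           = λ {u} {v} u≢v →
        let b , u∈ , v∈ = join (u≢v ∘ f-injective) in
        from b , subst (f u on_) (sym (strictlyInverseˡ b)) u∈
               , subst (f v on_) (sym (strictlyInverseˡ b)) v∈
    ; unique         = λ u≢v → unique (u≢v ∘ f-injective)
    }
    where
    open LinearSpace S
    open Inverse B′↔B using (to; from; strictlyInverseˡ)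

  -- Ordered pairs, diagonal included, serve as blocks. The count n² is crude, but it suffices to
  -- start a recursion that halves the error in each round.
  allPairs : ∀ k n → LinearSpace (2 + k) (Fin n) (Fin n × Fin n)
  allPairs k n = record
    { _on_           = On
    ; _on?_          = λ { p (a , b) → (p ≟ᶠ a) ⊎-dec (p ≟ᶠ b) }
    ; slot           = λ { p (a , _) → slot (p ≟ᶠ a) }
    ; slot-injective = λ {u} {v} → slot-injective (u ≟ᶠ _) (v ≟ᶠ _)
    ; join           = λ {u} {v} _ → (u , v) , inj₁ refl , inj₂ refl
    ; unique         = unique
    }
    where
    On : Fin n → Fin n × Fin n → Set
    On p (a , b) = p ≡ a ⊎ p ≡ b

    slot : ∀ {p a : Fin n} → Dec (p ≡ a) → Fin (2 + k)
    slot (yes _) = zero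
    slot (no  _) = suc zero

    slot-injective : ∀ {u v a b} (u≟a : Dec (u ≡ a)) (v≟a : Dec (v ≡ a)) →
                     On u (a , b) → On v (a , b) → slot u≟a ≡ slot v≟a → u ≡ v
    slot-injective (yes u≡a) (yes v≡a) _ _ _ = trans u≡a (sym v≡a)
    slot-injective (no u≢a) (no v≢a) (inj₁ u≡a) _          _ = contradiction u≡a u≢a
    slot-injective (no u≢a) (no v≢a) (inj₂ _)   (inj₁ v≡a) _ = contradiction v≡a v≢a
    slot-injective (no u≢a) (no v≢a) (inj₂ u≡b) (inj₂ v≡b) _ = trans u≡b (sym v≡b)

    unique : ∀ {u v w x y} → u ≢ v → On u x → On v x → On u y → On v y → On w x → On w y
    unique u≢v (inj₁ refl) (inj₁ refl) _  _  _           = contradiction refl u≢v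
    unique u≢v (inj₂ refl) (inj₂ refl) _  _  _           = contradiction refl u≢v
    unique u≢v (inj₁ refl) (inj₂ refl) u∈ v∈ (inj₁ refl) = u∈
    unique u≢v (inj₁ refl) (inj₂ refl) u∈ v∈ (inj₂ refl) = v∈
    unique u≢v (inj₂ refl) (inj₁ refl) u∈ v∈ (inj₁ refl) = v∈
    unique u≢v (inj₂ refl) (inj₁ refl) u∈ v∈ (inj₂ refl) = u∈

  -- Finite maps and congruences

  -- A missed value `y`, used as one more image, would embed `Fin (suc n)` in `Fin n`.
  injective⇒surjective : ∀ {n} {f : Fin n → Fin n} → Injective _≡_ _≡_ f → ∀ y → ∃[ x ] f x ≡ y
  injective⇒surjective {n} {f} f-injective y with any? (λ x → f x ≟ᶠ y)
  ... | yes hit  = hit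
  ... | no  miss = contradiction (injective⇒≤ g-injective) 1+n≰n
    where
    g : Fin (suc n) → Fin n
    g zero    = y
    g (suc x) = f x

    g-injective : Injective _≡_ _≡_ g
    g-injective {zero}  {zero}  _  = refl
    g-injective {zero}  {suc x} eq = contradiction (x , sym eq) miss
    g-injective {suc x} {zero}  eq = contradiction (x , eq) miss
    g-injective {suc x} {suc y} eq = cong suc (f-injective eq)

  -- Modulo q = 1 + p, the inverse of a divisor δ of p is −p/δ, so cancelling δ
  -- needs no Bézout identity.

  module Congruence (p : ℕ) where

    private
      q = suc p

    infix 4 _∼_
    -- A record, unlike a bare equation of remainders, lets `a` and `b` be inferred from the type.
    record _∼_ (a b : ℕ) : Set where
      constructor same-%
      field %≡ : a % q ≡ b % q
    open _∼_ public

    ∼-sym : ∀ {a b} → a ∼ b → b ∼ a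
    ∼-sym (same-% eq) = same-% (sym eq)

    ∼-trans : ∀ {a b c} → a ∼ b → b ∼ c → a ∼ c
    ∼-trans (same-% eq) (same-% eq′) = same-% (trans eq eq′)

    +-congˡ-∼ : ∀ {b b′} a → b ∼ b′ → a + b ∼ a + b′
    +-congˡ-∼ {b} {b′} a (same-% eq) = same-% (begin
      (a + b) % q           ≡⟨ %-distribˡ-+ a b q ⟩
      (a % q + b % q) % q   ≡⟨ cong (λ x → (a % q + x) % q) eq ⟩
      (a % q + b′ % q) % q  ≡⟨ %-distribˡ-+ a b′ q ⟨
      (a + b′) % q          ∎)
      where open ≡-Reasoning

    *-congʳ-∼ : ∀ {a a′} b → a ∼ a′ → a * b ∼ a′ * b
    *-congʳ-∼ {a} {a′} b (same-% eq) = same-% (begin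
      (a * b) % q             ≡⟨ %-distribˡ-* a b q ⟩
      (a % q * (b % q)) % q   ≡⟨ cong (λ x → (x * (b % q)) % q) eq ⟩
      (a′ % q * (b % q)) % q  ≡⟨ %-distribˡ-* a′ b q ⟨
      (a′ * b) % q            ∎)
      where open ≡-Reasoning

    -- `c * p` is an additive inverse of c, since c p + c = c q.
    +-cancelˡ-∼ : ∀ {a b} c → c + a ∼ c + b → a ∼ b
    +-cancelˡ-∼ {a} {b} c c+a∼c+b =
      ∼-trans (∼-sym (wrap a)) (∼-trans (+-congˡ-∼ (c * p) c+a∼c+b) (wrap b))
      where
      regroup : ∀ c p x → c * p + (c + x) ≡ x + c * suc p
      regroup = solve-∀

      wrap : ∀ x → c * p + (c + x) ∼ x
      wrap x = same-% (trans (cong (_% q) (regroup c p x)) ([m+kn]%n≡m%n x c q))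

    *-cancelʳ-∼ : ∀ {a b δ} → δ ∣ p → a * δ ∼ b * δ → a ∼ b
    -- Multiplication by p is negation modulo q. Multiplying the hypothesis by e gives a p ∼ b p, so
    -- a p + b ∼ b p + b ∼ 0 ∼ a p + a.
    *-cancelʳ-∼ {a} {b} {δ} (divides e p≡eδ) aδ∼bδ = +-cancelˡ-∼ (a * p)
      (∼-trans (vanish a) (∼-trans (∼-sym (vanish b)) (swap b (a * p) (*-∼ aδ∼bδ))))
      where
      vanish : ∀ x → x * p + x ∼ 0
      vanish x = same-% (trans (cong (_% q) (trans (+-comm (x * p) x) (sym (*-suc x p))))
        ([m+kn]%n≡m%n 0 x q))

      expand : ∀ x → x * δ * e ≡ x * p
      expand x = trans (*-assoc x δ e) (cong (x *_) (trans (*-comm δ e) (sym p≡eδ)))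

      *-∼ : a * δ ∼ b * δ → a * p ∼ b * p
      *-∼ = subst₂ _∼_ (expand a) (expand b) ∘ *-congʳ-∼ e

      swap : ∀ x y {z} → y ∼ z → z + x ∼ y + x
      swap x y {z} y∼z = subst₂ _∼_ (+-comm x z) (+-comm x y) (+-congˡ-∼ x (∼-sym y∼z))

    -- The values at j and j + δ differ by c δ, and cancelling δ leaves the slope; the intercept
    -- follows.
    affine-injective : ∀ {a a′ c c′} j {δ} → δ ∣ p → a + c * j ∼ a′ + c′ * j →
                       a + c * (j + δ) ∼ a′ + c′ * (j + δ) → a ∼ a′ × c ∼ c′
    affine-injective {a} {a′} {c} {c′} j {δ} δ∣p at-j at-j+δ = a∼a′ , c∼c′
      where
      split : ∀ a c j δ → a + c * (j + δ) ≡ (a + c * j) + c * δ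
      split = solve-∀

      c∼c′ : c ∼ c′
      c∼c′ = *-cancelʳ-∼ δ∣p (+-cancelˡ-∼ (a′ + c′ * j)
        (∼-trans (subst₂ _∼_ (+-comm (c * δ) _) (+-comm (c * δ) _)
                   (+-congˡ-∼ (c * δ) (∼-sym at-j)))
                 (subst₂ _∼_ (split a c j δ) (split a′ c′ j δ) at-j+δ)))

      a∼a′ : a ∼ a′
      a∼a′ = +-cancelˡ-∼ (c * j)
        (∼-trans (subst (_∼ a′ + c′ * j) (+-comm a (c * j)) at-j)
        (subst (a′ + c′ * j ∼_) (+-comm a′ (c * j)) (+-congˡ-∼ a′ (*-congʳ-∼ j (∼-sym c∼c′)))))

  -- Transversal designs

  -- The transversal design with k groups of size q = 1 + p: the block (a , c) is
  -- the line j ↦ a + c j modulo q, and the points of a group are joined by a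
  -- smaller space.

  module TransversalDesign {k p : ℕ} (small∣p : ∀ {δ} → 0 < δ → δ < k → δ ∣ p) where

    open Congruence p

    private
      q = suc p

    opaque

      value : Fin k → Fin q × Fin q → Fin q
      value j (a , c) = (toℕ a + toℕ c * toℕ j) mod q

      value≡⇒∼ : ∀ j {a a′ c c′} → value j (a , c) ≡ value j (a′ , c′) →
                 toℕ a + toℕ c * toℕ j ∼ toℕ a′ + toℕ c′ * toℕ j
      value≡⇒∼ j {a} {a′} {c} {c′} eq = same-% (trans
        (sym (toℕ-fromℕ< (m%n<n (toℕ a + toℕ c * toℕ j) q)))
        (trans (cong toℕ eq) (toℕ-fromℕ< (m%n<n (toℕ a′ + toℕ c′ * toℕ j) q))))

    private
      ∼⇒≡ : ∀ {a b : Fin q} → toℕ a ∼ toℕ b → a ≡ b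
      ∼⇒≡ {a} {b} (same-% eq) = toℕ-injective
        (trans (sym (m<n⇒m%n≡m (toℕ<n a))) (trans eq (m<n⇒m%n≡m (toℕ<n b))))

      value-injective-< : ∀ {j j′ x x′} → toℕ j < toℕ j′ →
                          value j x ≡ value j x′ → value j′ x ≡ value j′ x′ → x ≡ x′
      value-injective-< {j} {j′} {a , c} {a′ , c′} j<j′ at-j at-j′ =
        cong₂ _,_ (∼⇒≡ (proj₁ coefficients)) (∼⇒≡ (proj₂ coefficients))
        where
        coefficients : toℕ a ∼ toℕ a′ × toℕ c ∼ toℕ c′
        -- The gap j′ - j is positive and below k, so it divides p.
        coefficients = affine-injective (toℕ j)
          (small∣p (m<n⇒0<n∸m j<j′) (≤-<-trans (m∸n≤m (toℕ j′) (toℕ j)) (toℕ<n j′)))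
          (value≡⇒∼ j at-j)
          (subst (λ i → toℕ a + toℕ c * i ∼ toℕ a′ + toℕ c′ * i)
            (sym (m+[n∸m]≡n (<⇒≤ j<j′))) (value≡⇒∼ j′ at-j′))

    value-injective : ∀ {j j′ x x′} → j ≢ j′ →
                      value j x ≡ value j x′ → value j′ x ≡ value j′ x′ → x ≡ x′
    value-injective {j} {j′} j≢j′ at-j at-j′ with <-cmp (toℕ j) (toℕ j′)
    ... | tri< j<j′ _ _ = value-injective-< j<j′ at-j at-j′
    ... | tri≈ _ j≡j′ _ = contradiction (toℕ-injective j≡j′) j≢j′
    ... | tri> _ _ j>j′ = value-injective-< j>j′ at-j′ at-j

    -- No equations are solved: x ↦ (`value j x`, `value j′ x`) is an injective map between sets of
    -- q² elements, hence onto.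
    value-surjective : ∀ {j j′} → j ≢ j′ → ∀ y y′ → ∃[ x ] value j x ≡ y × value j′ x ≡ y′
    value-surjective {j} {j′} j≢j′ y y′ =
      let i , eq = injective⇒surjective values-injective (combine y y′) in
      decode i , combine-injective _ _ _ _ eq
      where
      decode : Fin (q * q) → Fin q × Fin q
      decode = remQuot {q} q

      values : Fin (q * q) → Fin (q * q)
      values i = combine (value j (decode i)) (value j′ (decode i))

      values-injective : Injective _≡_ _≡_ values
      values-injective {i} {i′} eq =
        let at-j , at-j′ = combine-injective _ _ _ _ eq
            same         = value-injective {x = decode i} {decode i′} j≢j′ at-j at-j′
        in trans (sym (combine-remQuot {q} q i))
             (trans (cong (λ (a , c) → combine a c) same) (combine-remQuot {q} q i′))

    module _ {B : Set} (S : LinearSpace k (Fin q) B) where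
      open LinearSpace S

      private
        Point = Fin k × Fin q
        Block = (Fin q × Fin q) ⊎ (Fin k × B)

        On : Point → Block → Set
        On (j , x) (inj₁ l)       = x ≡ value j l
        On (j , x) (inj₂ (i , b)) = j ≡ i × x on b

        on-dec : ∀ p b → Dec (On p b)
        on-dec (j , x) (inj₁ l)       = x ≟ᶠ value j l
        on-dec (j , x) (inj₂ (i , b)) = (j ≟ᶠ i) ×-dec (x on? b)

        slot′ : Point → Block → Fin k
        slot′ (j , x) (inj₁ _)       = j
        slot′ (j , x) (inj₂ (_ , b)) = slot x b

        slot′-injective : ∀ {u v} b → On u b → On v b → slot′ u b ≡ slot′ v b → u ≡ v
        slot′-injective (inj₁ _) refl        refl        refl = refl
        slot′-injective (inj₂ _) (refl , u∈) (refl , v∈) eq   =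
          cong (_ ,_) (slot-injective u∈ v∈ eq)

        join′ : ∀ {u v} → u ≢ v → ∃[ b ] On u b × On v b
        join′ {j , x} {j′ , x′} u≢v with j ≟ᶠ j′
        ... | yes refl =
          let b , x∈ , x′∈ = join (u≢v ∘ cong (j ,_)) in
          inj₂ (j , b) , (refl , x∈) , (refl , x′∈)
        ... | no j≢j′ =
          let l , eq , eq′ = value-surjective j≢j′ x x′ in
          inj₁ l , sym eq , sym eq′

        -- A line has just one point in group i, while a block of the second kind lies inside that
        -- group.
        meet≤1 : ∀ {u v l i b} → On u (inj₁ l) → On v (inj₁ l) →
                 On u (inj₂ (i , b)) → On v (inj₂ (i , b)) → u ≡ v
        meet≤1 refl refl (refl , _) (refl , _) = refl

        -- Two lines with common points in different groups coincide by `value-injective`; a line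
        -- and a block inside a group are excluded by `meet≤1`; two blocks inside a group reduce to
        -- `S`.
        unique′ : ∀ {u v w} b b′ → u ≢ v → On u b → On v b → On u b′ → On v b′ →
                  On w b → On w b′
        unique′ {j , _} {j′ , _} {w} (inj₁ l) (inj₁ l′) u≢v refl refl u∈ v∈ w∈
          with j ≟ᶠ j′
        ... | yes refl = contradiction refl u≢v
        ... | no j≢j′  = subst (On w ∘ inj₁) (value-injective j≢j′ u∈ v∈) w∈
        unique′ {u} {v} (inj₁ _) (inj₂ (i , b)) u≢v u∈ v∈ u∈′ v∈′ w∈ =
          contradiction (meet≤1 {u} {v} {i = i} {b} u∈ v∈ u∈′ v∈′) u≢v
        unique′ {u} {v} (inj₂ (i , b)) (inj₁ _) u≢v u∈ v∈ u∈′ v∈′ w∈ =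
          contradiction (meet≤1 {u} {v} {i = i} {b} u∈′ v∈′ u∈ v∈) u≢v
        unique′ (inj₂ _) (inj₂ _) u≢v (refl , u∈) (refl , v∈) (refl , u∈′) (_ , v∈′) (refl , w∈) =
          refl , unique (u≢v ∘ cong (_ ,_)) u∈ v∈ u∈′ v∈′ w∈

      transversalDesign : LinearSpace k (Fin k × Fin q) ((Fin q × Fin q) ⊎ (Fin k × B))
      transversalDesign = record
        { _on_           = On
        ; _on?_          = on-dec
        ; slot           = slot′
        ; slot-injective = λ {_} {_} {b} → slot′-injective b
        ; join           = join′
        ; unique         = λ {_} {_} {_} {b} {b′} → unique′ b b′
        }


  -- Linear spaces on n points

  trivial-space : ∀ κ n → LinearSpace (2 + κ) (Fin n) (Fin (n * n))
  trivial-space κ n = relabel id id *↔× (allPairs κ n)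

  -- The n points are embedded among the k q points of the design, whose blocks are q² lines and one
  -- copy of the blocks of the smaller space in each of the k groups.
  recursive-space : ∀ {k p n f} → (∀ {δ} → 0 < δ → δ < k → δ ∣ p) → n ≤ k * suc p →
                    LinearSpace k (Fin (suc p)) (Fin f) →
                    LinearSpace k (Fin n) (Fin (suc p * suc p + k * f))
  recursive-space {k} {p} {n} {f} small∣p n≤kq S =
    relabel (λ x → remQuot {k} (suc p) (inject≤ x n≤kq)) points-injective
      ((*↔× ⊎-↔ *↔×) ↔-∘ +↔⊎)
      (TransversalDesign.transversalDesign small∣p S)
    where
    points-injective : Injective _≡_ _≡_ (λ x → remQuot {k} (suc p) (inject≤ x n≤kq))
    points-injective {x} {y} eq = inject≤-injective n≤kq n≤kq x y
      (trans (sym (combine-remQuot {k} (suc p) (inject≤ x n≤kq)))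
        (trans (cong (λ (a , c) → combine a c) eq)
          (combine-remQuot {k} (suc p) (inject≤ y n≤kq))))

  -- Elements of finite subsets

  member : (S : Subset m) → Fin ∣ S ∣ → Fin m
  member (inside  ∷ S) zero    = zero
  member (inside  ∷ S) (suc i) = suc (member S i)
  member (outside ∷ S) i       = suc (member S i)

  member-∈ : (S : Subset m) (i : Fin ∣ S ∣) → member S i ∈ S
  member-∈ (inside  ∷ S) zero    = here
  member-∈ (inside  ∷ S) (suc i) = there (member-∈ S i)
  member-∈ (outside ∷ S) i       = there (member-∈ S i)

  member-injective : (S : Subset m) → Injective _≡_ _≡_ (member S)
  member-injective (inside  ∷ S) {zero}  {zero}  _  = refl
  member-injective (inside  ∷ S) {suc i} {suc j} eq =
    cong suc (member-injective S (suc-injective eq))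
  member-injective (outside ∷ S)                 eq = member-injective S (suc-injective eq)

  -- The number of elements of S that precede x. It is defined for every x, so its value involves no
  -- membership proof.
  rank : Subset m → Fin m → ℕ
  rank (_       ∷ S) zero    = 0
  rank (inside  ∷ S) (suc x) = suc (rank S x)
  rank (outside ∷ S) (suc x) = rank S x

  rank<∣S∣ : ∀ {S : Subset m} {x} → x ∈ S → rank S x < ∣ S ∣
  rank<∣S∣                      here       = s≤s z≤n
  rank<∣S∣ {S = inside  ∷ _} (there x∈S) = s≤s (rank<∣S∣ x∈S)
  rank<∣S∣ {S = outside ∷ _} (there x∈S) = rank<∣S∣ x∈S

  rank-injective : ∀ {S : Subset m} {x y} → x ∈ S → y ∈ S → rank S x ≡ rank S y → x ≡ y
  rank-injective                    here        here        _  = refl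
  rank-injective {S = inside  ∷ _} (there x∈S) (there y∈S) eq =
    cong suc (rank-injective x∈S y∈S (cong pred eq))
  rank-injective {S = outside ∷ _} (there x∈S) (there y∈S) eq =
    cong suc (rank-injective x∈S y∈S eq)

  x≢y∈S⇒2≤∣S∣ : ∀ {S : Subset m} {x y} → x ≢ y → x ∈ S → y ∈ S → 2 ≤ ∣ S ∣
  x≢y∈S⇒2≤∣S∣ {S = S} {x} {y} x≢y x∈S y∈S = begin-strict
    1                  ≤⟨ s≤s z≤n ⟩
    suc ∣ S - x - y ∣  ≤⟨ x∈p⇒∣p-x∣<∣p∣ (x∈p∧x≢y⇒x∈p-y y∈S (x≢y ∘ sym)) ⟩
    ∣ S - x ∣          <⟨ x∈p⇒∣p-x∣<∣p∣ x∈S ⟩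
    ∣ S ∣              ∎
    where open ≤-Reasoning

  2≤∣S∣⇒x≢y∈S : (S : Subset m) → 2 ≤ ∣ S ∣ → ∃[ x ] ∃[ y ] x ≢ y × x ∈ S × y ∈ S
  2≤∣S∣⇒x≢y∈S S 2≤∣S∣ =
    member S i , member S j , i≢j ∘ member-injective S , member-∈ S i , member-∈ S j
    where
    i j : Fin ∣ S ∣
    i = inject≤ zero 2≤∣S∣
    j = inject≤ (suc zero) 2≤∣S∣
    i≢j : i ≢ j
    i≢j eq with () ← inject≤-injective {m = 2} 2≤∣S∣ 2≤∣S∣ zero (suc zero) eq

  -- Affine closures

  ∈-⋂⁺ : ∀ {x} {Ss : List (Subset m)} → All (x ∈_) Ss → x ∈ ⋂ Ss
  ∈-⋂⁺ []          = ∈⊤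
  ∈-⋂⁺ (x∈S ∷ x∈) = x∈p∩q⁺ (x∈S , ∈-⋂⁺ x∈)

  ∈-⋂⁻ : ∀ {x} {Ss : List (Subset m)} → x ∈ ⋂ Ss → All (x ∈_) Ss
  ∈-⋂⁻ {Ss = []}     _   = []
  ∈-⋂⁻ {Ss = S ∷ Ss} x∈ with x∈S , x∈Ss ← x∈p∩q⁻ S (⋂ Ss) x∈ = x∈S ∷ ∈-⋂⁻ x∈Ss

  module _ (H : Hypergraph m) {S : Subset m} where

    aff-least : ∀ {T} → ClosedSuperset H S T → aff H S ⊆ T
    aff-least closed x∈ =
      All.lookup (∈-⋂⁻ x∈) (∈-filter⁺ (closedSuperset? H S) (∈-subsets _) closed)

    aff-greatest : ∀ {R} → (∀ {T} → ClosedSuperset H S T → R ⊆ T) → R ⊆ aff H S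
    aff-greatest below x∈R = ∈-⋂⁺ (All.tabulate λ T∈ →
      below (proj₂ (∈-filter⁻ (closedSuperset? H S) {xs = subsets m} T∈)) x∈R)

  u∈⁅u⁆∪⁅v⁆ : ∀ (u v : Fin m) → u ∈ ⁅ u ⁆ ∪ ⁅ v ⁆
  u∈⁅u⁆∪⁅v⁆ u v = x∈p∪q⁺ {p = ⁅ u ⁆} (inj₁ (x∈⁅x⁆ u))

  v∈⁅u⁆∪⁅v⁆ : ∀ (u v : Fin m) → v ∈ ⁅ u ⁆ ∪ ⁅ v ⁆
  v∈⁅u⁆∪⁅v⁆ u v = x∈p∪q⁺ {p = ⁅ u ⁆} (inj₂ (x∈⁅x⁆ v))

  ⁅u⁆∪⁅v⁆⊆ : ∀ {u v : Fin m} {T} → u ∈ T → v ∈ T → ⁅ u ⁆ ∪ ⁅ v ⁆ ⊆ T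
  ⁅u⁆∪⁅v⁆⊆ {u = u} {v} {T} u∈T v∈T x∈ =
    [ (λ x∈u → subst (_∈ T) (sym (x∈⁅y⁆⇒x≡y u x∈u)) u∈T)
    , (λ x∈v → subst (_∈ T) (sym (x∈⁅y⁆⇒x≡y v x∈v)) v∈T) ]′ (x∈p∪q⁻ ⁅ u ⁆ ⁅ v ⁆ x∈)

  -- Lists without repetition

  -- This makes the length of `closureLines` a count of distinct lines.
  subsets-unique : ∀ n → Unique (subsets n)
  subsets-unique zero    = [] ∷ []
  subsets-unique (suc n) = Unique.++⁺
    (Unique.map⁺ ∷-injectiveʳ (subsets-unique n))
    (Unique.map⁺ ∷-injectiveʳ (subsets-unique n))
    λ (∈in , ∈out) → disjoint (∈-map⁻ (inside ∷_) ∈in) (∈-map⁻ (outside ∷_) ∈out)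
    where
    disjoint : ∀ {S} → ∃[ T ] T ∈ˡ subsets n × S ≡ inside ∷ T →
               ∃[ T ] T ∈ˡ subsets n × S ≡ outside ∷ T → ⊥
    disjoint (_ , _ , refl) (_ , _ , ())

  -- Sending a position in `xs` to the position of the same element in `ys` is injective, because
  -- `xs` has no repetition.
  Unique-⊆⇒length≤ : ∀ {A : Set} {xs ys : List A} → Unique xs →
                     (∀ {x} → x ∈ˡ xs → x ∈ˡ ys) → length xs ≤ length ys
  Unique-⊆⇒length≤ {xs = xs} {ys} unique xs⊆ys = injective⇒≤ position-injective
    where
    xsᵢ∈ys : ∀ i → lookup xs i ∈ˡ ys
    xsᵢ∈ys i = xs⊆ys (∈-lookup i)

    lookup-injective : ∀ {zs} → Unique zs → Injective _≡_ _≡_ (lookup zs)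
    lookup-injective {_ ∷ _} _         {zero}  {zero}  _  = refl
    lookup-injective {_ ∷ _} (≢s ∷ _)  {zero}  {suc j} eq =
      contradiction eq (All.lookup ≢s (∈-lookup j))
    lookup-injective {_ ∷ _} (≢s ∷ _)  {suc i} {zero}  eq =
      contradiction (sym eq) (All.lookup ≢s (∈-lookup i))
    lookup-injective {_ ∷ _} (_ ∷ uq)  {suc i} {suc j} eq = cong suc (lookup-injective uq eq)

    position-injective : Injective _≡_ _≡_ (λ i → index (xsᵢ∈ys i))
    position-injective {i} {j} eq = lookup-injective unique
      (trans (lookup-index (xsᵢ∈ys i))
        (trans (cong (lookup ys) eq) (sym (lookup-index (xsᵢ∈ys j)))))

  -- Upper bound: closure-lines of a linear space

  module _ {n f k : ℕ} (S : LinearSpace k (Fin n) (Fin f)) where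
    open LinearSpace S

    block : Fin f → Subset n
    block b = Vec.tabulate (λ p → does (p on? b))

    ∈-block⁺ : ∀ {p b} → p on b → p ∈ block b
    ∈-block⁺ {p} {b} p-on-b = lookup⇒[]= p (block b)
      (trans (lookup∘tabulate _ p) (dec-true (p on? b) p-on-b))

    ∈-block⁻ : ∀ {p b} → p ∈ block b → p on b
    ∈-block⁻ {p} {b} p∈ with p on? b
      | trans (sym ([]=⇒lookup p∈)) (lookup∘tabulate (λ p → does (p on? b)) p)
    ... | yes p-on-b | _  = p-on-b
    ... | no  _      | ()

    ∣block∣≤k : ∀ b → ∣ block b ∣ ≤ k
    ∣block∣≤k b = injective⇒≤ λ {i} {j} eq → member-injective (block b)
      (slot-injective (∈-block⁻ (member-∈ (block b) i)) (∈-block⁻ (member-∈ (block b) j)) eq)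

    blocks : Hypergraph n
    blocks = List.tabulate block

    -- An edge sharing two points with the block lies inside it by `unique`.
    block-closed : ∀ b → AffinelyClosed blocks (block b)
    block-closed b = tabulate⁺ λ b′ 2≤ {w} w∈ →
      let u , v , u≢v , u∈ , v∈ = 2≤∣S∣⇒x≢y∈S (block b′ ∩ block b) 2≤
          u∈b′ , u∈b = x∈p∩q⁻ (block b′) (block b) u∈
          v∈b′ , v∈b = x∈p∩q⁻ (block b′) (block b) v∈
      in ∈-block⁺ (unique u≢v (∈-block⁻ u∈b′) (∈-block⁻ v∈b′)
                               (∈-block⁻ u∈b) (∈-block⁻ v∈b) (∈-block⁻ w∈))

    -- The block joining u and v is a closed superset of the pair. Conversely it is an edge, so
    -- every closed set containing u and v contains it.
    line-is-block : ∀ {L} → IsClosureLine blocks L → ∃[ b ] L ≡ block b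
    line-is-block {L} (u , v , u≢v , L≡aff) = b , trans L≡aff (⊆-antisym aff⊆ ⊆aff)
      where
      b    = proj₁ (join u≢v)
      u∈b  = ∈-block⁺ (proj₁ (proj₂ (join u≢v)))
      v∈b  = ∈-block⁺ (proj₂ (proj₂ (join u≢v)))

      aff⊆ : aff blocks (⁅ u ⁆ ∪ ⁅ v ⁆) ⊆ block b
      aff⊆ = aff-least blocks (⁅u⁆∪⁅v⁆⊆ u∈b v∈b , block-closed b)

      ⊆aff : block b ⊆ aff blocks (⁅ u ⁆ ∪ ⁅ v ⁆)
      ⊆aff = aff-greatest blocks λ {T} (uv⊆T , closed) →
        All.lookup closed (∈-tabulate⁺ b) (x≢y∈S⇒2≤∣S∣ u≢v
          (x∈p∩q⁺ (u∈b , uv⊆T (u∈⁅u⁆∪⁅v⁆ u v)))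
          (x∈p∩q⁺ (v∈b , uv⊆T (v∈⁅u⁆∪⁅v⁆ u v))))

    blocks-bounded : LinesBoundedBy k blocks
    blocks-bounded L line with b , refl ← line-is-block line = ∣block∣≤k b

    lines≤f : length (closureLines blocks) ≤ f
    lines≤f = ≤-trans
      (Unique-⊆⇒length≤ (Unique.filter⁺ (isClosureLine? blocks) (subsets-unique n)) lines⊆blocks)
      (≤-reflexive (length-tabulate block))
      where
      lines⊆blocks : ∀ {L} → L ∈ˡ closureLines blocks → L ∈ˡ blocks
      lines⊆blocks L∈
        with b , refl ← line-is-block (proj₂ (∈-filter⁻ (isClosureLine? blocks) {xs = subsets n} L∈))
        = ∈-tabulate⁺ b

    m̅≤f : ∀ 2≤k → m̅ n k 2≤k ≤ f
    m̅≤f 2≤k = ≤-trans (IsMinimum.lowerBound (proj₂ (minimum n 2≤k)) blocks blocks-bounded) lines≤f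

  -- Lower bound: counting pairs of points

  -- A line has at most k (k − 1) ordered pairs of distinct points, and it is
  -- recovered from any such pair together with its own index.

  module _ {n k : ℕ} (H : Hypergraph (suc n)) (bounded : LinesBoundedBy (suc k) H) where

    private
      L : Fin (suc n) → Fin (suc n) → Subset (suc n)
      L u v = aff H (⁅ u ⁆ ∪ ⁅ v ⁆)

      module Flag (u : Fin (suc n)) (j : Fin n) where

        -- As j varies, v runs once through the points other than u.
        v = punchIn u j

        u≢v : u ≢ v
        u≢v = punchInᵢ≢i u j ∘ sym

        line : IsClosureLine H (L u v)
        line = u , v , u≢v , refl

        line∈ : L u v ∈ˡ closureLines H
        line∈ = ∈-filter⁺ (isClosureLine? H) (∈-subsets _) line

        u∈ : u ∈ L u v
        u∈ = aff-greatest H (λ (uv⊆T , _) → uv⊆T) (u∈⁅u⁆∪⁅v⁆ u v)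

        v∈ : v ∈ L u v
        v∈ = aff-greatest H (λ (uv⊆T , _) → uv⊆T) (v∈⁅u⁆∪⁅v⁆ u v)

        u-slot v-slot : Fin (suc k)
        u-slot = fromℕ< (<-≤-trans (rank<∣S∣ u∈) (bounded _ line))
        v-slot = fromℕ< (<-≤-trans (rank<∣S∣ v∈) (bounded _ line))

        slots-differ : u-slot ≢ v-slot
        slots-differ = u≢v ∘ rank-injective u∈ v∈ ∘ fromℕ<-injective _ _ _ _

        code : Fin (length (closureLines H) * (suc k * k))
        -- The two ranks differ, so `punchOut` leaves only k choices for the second: a line accounts
        -- for at most (k + 1) k codes.
        code = combine (index line∈) (combine u-slot (punchOut slots-differ))

      punchOut-cancel : ∀ {m} {i i′ j j′ : Fin (suc m)} {i≢j : i ≢ j} {i′≢j′ : i′ ≢ j′} →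
                        i ≡ i′ → punchOut i≢j ≡ punchOut i′≢j′ → j ≡ j′
      punchOut-cancel {i≢j = i≢j} {i′≢j′} refl eq = punchOut-injective i≢j i′≢j′ eq

      code-injective : ∀ {u j u′ j′} → Flag.code u j ≡ Flag.code u′ j′ → (u , j) ≡ (u′ , j′)
      code-injective {u} {j} {u′} {j′} eq = conclude u≡u′ v≡v′
        where
        module F = Flag u j
        module F′ = Flag u′ j′

        eqs = combine-injective (index F.line∈) _ (index F′.line∈) _ eq
        slot-eqs = combine-injective F.u-slot _ F′.u-slot _ (proj₂ eqs)

        L≡L′ : L u F.v ≡ L u′ F′.v
        L≡L′ = trans (lookup-index F.line∈)
          (trans (cong (lookup (closureLines H)) (proj₁ eqs)) (sym (lookup-index F′.line∈)))

        -- With the two lines abstracted to variables, their equality can be matched with `refl`.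
        same-point : ∀ {K K′ : Subset (suc n)} {x x′} → K ≡ K′ → x ∈ K → x′ ∈ K′ →
                     rank K x ≡ rank K′ x′ → x ≡ x′
        same-point refl = rank-injective

        u≡u′ : u ≡ u′
        u≡u′ = same-point L≡L′ F.u∈ F′.u∈ (fromℕ<-injective _ _ _ _ (proj₁ slot-eqs))

        v≡v′ : F.v ≡ F′.v
        v≡v′ = same-point L≡L′ F.v∈ F′.v∈
          (fromℕ<-injective _ _ _ _ (punchOut-cancel (proj₁ slot-eqs) (proj₂ slot-eqs)))

        conclude : u ≡ u′ → punchIn u j ≡ punchIn u′ j′ → (u , j) ≡ (u′ , j′)
        conclude refl v≡v′ = cong (u ,_) (punchIn-injective u j j′ v≡v′)

    pairs≤lines : suc n * n ≤ length (closureLines H) * (suc k * k)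
    pairs≤lines = injective⇒≤ {f = encode} encode-injective
      where
      encode : Fin (suc n * n) → Fin (length (closureLines H) * (suc k * k))
      encode i = let u , j = remQuot {suc n} n i in Flag.code u j

      encode-injective : Injective _≡_ _≡_ encode
      encode-injective {x} {y} eq = trans (sym (combine-remQuot {suc n} n x))
        (trans (cong (λ (u , j) → combine u j) (code-injective eq)) (combine-remQuot {suc n} n y))

  lowerBound : ∀ n k 2≤k → n * (n ∸ 1) ≤ m̅ n k 2≤k * (k * (k ∸ 1))
  lowerBound zero    k       2≤k = z≤n
  lowerBound (suc n) (suc k) 2≤k
    with record { attained = H , bounded , eq } ← proj₂ (minimum (suc n) 2≤k) =
    subst (λ m → suc n * n ≤ m * (suc k * k)) eq (pairs≤lines H bounded)

  -- Block counts of the recursion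

  n<2^n : ∀ n → n < 2 ^ n
  n<2^n zero    = s≤s z≤n
  n<2^n (suc n) = +-mono-≤ (≤-trans (s≤s z≤n) (n<2^n n)) (≤-trans (n<2^n n) (m≤m+n (2 ^ n) 0))

  -- Together with the next bound: rounding n up to this multiple of N overshoots by at most N,
  -- however large n is.
  n≤N*[1+n/N] : ∀ n N .{{_ : NonZero N}} → n ≤ N * suc (n / N)
  n≤N*[1+n/N] n N = begin
    n                    ≡⟨ m≡m%n+[m/n]*n n N ⟩
    n % N + n / N * N    ≤⟨ +-monoˡ-≤ (n / N * N) (<⇒≤ (m%n<n n N)) ⟩
    N + n / N * N        ≡⟨ *-comm (suc (n / N)) N ⟩
    N * suc (n / N)      ∎
    where open ≤-Reasoning

  N*[1+n/N]≤n+N : ∀ n N .{{_ : NonZero N}} → N * suc (n / N) ≤ n + N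
  N*[1+n/N]≤n+N n N = begin
    N * suc (n / N)  ≡⟨ *-comm N (suc (n / N)) ⟩
    N + n / N * N    ≤⟨ +-monoʳ-≤ N (m/n*n≤m n N) ⟩
    N + n            ≡⟨ +-comm N n ⟩
    n + N            ∎
    where open ≤-Reasoning

  -- δ divides δ!, which divides k!. Hence q = 1 + k! t is admissible for every t.
  small∣k! : ∀ {k δ} t → 0 < δ → δ < k → δ ∣ k ! * t
  small∣k! {k} {suc δ} t _ δ<k =
    ∣-trans (m∣m*n (δ !)) (∣-trans (m≤n⇒m!∣n! (<⇒≤ δ<k)) (m∣m*n t))

  -- Collects the terms of lower order in (2D + K)(n + B)² + 2A(n + B), with constants bounded by
  -- multiples of n as n ≥ 1.
  recursion-constant : (D K A B : ℕ) → ℕ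
  recursion-constant D K A B = (2 * D + K) * (2 * B + B * B) + 2 * A * (1 + B)

  -- The hypothesis says f ≤ (1/K + 1/D) q² + O(q). One round replaces D by 2D, because only about
  -- 1/k ≤ 1/2 of the pairs lie inside groups, where the excess arises.
  recursion-bound : ∀ κ {D A B f q n} → let k = 2 + κ ; K = k * (1 + κ) in
    D * K * f ≤ (D + K) * (q * q) + A * q → k * q ≤ n + B → 1 ≤ n →
    2 * D * K * (q * q + k * f) ≤ (2 * D + K) * (n * n) + recursion-constant D K A B * n
  recursion-bound κ {D} {A} {B} {f} {q} {suc n} ih kq≤n+B _ = begin
    2 * D * K * (q * q + k * f)
      ≡⟨ expand D K q k f ⟩
    2 * D * K * (q * q) + 2 * k * (D * K * f)
      ≤⟨ +-monoʳ-≤ (2 * D * K * (q * q)) (*-monoʳ-≤ (2 * k) ih) ⟩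
    2 * D * K * (q * q) + 2 * k * ((D + K) * (q * q) + A * q)
      -- The added term raises 2 k K q² to k² K q², so that the quadratic part becomes a multiple of
      -- (k q)².
      ≤⟨ m≤m+n _ (κ * k * K * (q * q)) ⟩
    2 * D * K * (q * q) + 2 * k * ((D + K) * (q * q) + A * q) + κ * k * K * (q * q)
      ≡⟨ collect D κ A q ⟩
    (2 * D + K) * (k * q * (k * q)) + 2 * A * (k * q)
      ≤⟨ +-mono-≤ (*-monoʳ-≤ (2 * D + K) (*-mono-≤ kq≤n+B kq≤n+B)) (*-monoʳ-≤ (2 * A) kq≤n+B) ⟩
    (2 * D + K) * ((suc n + B) * (suc n + B)) + 2 * A * (suc n + B)
      -- The added terms turn the constants B² and B into B² (n + 1) and B (n + 1).
      ≤⟨ m≤m+n _ ((2 * D + K) * (B * B * n) + 2 * A * (B * n)) ⟩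
    (2 * D + K) * ((suc n + B) * (suc n + B)) + 2 * A * (suc n + B) +
      ((2 * D + K) * (B * B * n) + 2 * A * (B * n))
      ≡⟨ regroup D K A B n ⟩
    (2 * D + K) * (suc n * suc n) + recursion-constant D K A B * suc n
      ∎
    where
    open ≤-Reasoning
    k = 2 + κ
    K = k * (1 + κ)

    expand : ∀ D K q k f → 2 * D * K * (q * q + k * f) ≡
                           2 * D * K * (q * q) + 2 * k * (D * K * f)
    expand = solve-∀

    collect : ∀ D κ A q →
      2 * D * ((2 + κ) * (1 + κ)) * (q * q) +
        2 * (2 + κ) * ((D + (2 + κ) * (1 + κ)) * (q * q) + A * q) +
        κ * (2 + κ) * ((2 + κ) * (1 + κ)) * (q * q)
      ≡ (2 * D + (2 + κ) * (1 + κ)) * ((2 + κ) * q * ((2 + κ) * q)) + 2 * A * ((2 + κ) * q)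
    collect = solve-∀

    regroup : ∀ D K A B n →
      (2 * D + K) * ((suc n + B) * (suc n + B)) + 2 * A * (suc n + B) +
        ((2 * D + K) * (B * B * n) + 2 * A * (B * n))
      ≡ (2 * D + K) * (suc n * suc n) + ((2 * D + K) * (2 * B + B * B) + 2 * A * (1 + B)) * suc n
    regroup = solve-∀

  -- After d rounds D = 2ᵈ, so f ≤ (1/K + 2⁻ᵈ) n² + O(n), where `A` depends on κ and d but not on n.
  sparse-spaces : ∀ κ d → let k = 2 + κ ; K = k * (1 + κ) in
    ∃[ A ] ∀ n → 1 ≤ n → ∃[ f ] LinearSpace k (Fin n) (Fin f) ×
      2 ^ d * K * f ≤ (2 ^ d + K) * (n * n) + A * n
  sparse-spaces κ zero = 0 , λ n _ → n * n , trivial-space κ n , bound n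
    where
    K = (2 + κ) * (1 + κ)
    bound : ∀ n → 1 * K * (n * n) ≤ (1 + K) * (n * n) + 0
    bound n = ≤-trans
      (*-monoˡ-≤ (n * n) (≤-trans (≤-reflexive (*-identityˡ K)) (n≤1+n K)))
      (m≤m+n _ 0)
  sparse-spaces κ (suc d) = let A , spaces = sparse-spaces κ d in
    -- Since q = 1 + k! t, the design has k q = k + N t points; t is taken so that n ≤ N t ≤ n + N,
    -- and the overshoot k q - n is at most k + N.
    recursion-constant (2 ^ d) K A (k + N) , λ n 1≤n →
      let t            = suc (n / N)
          q            = suc (k ! * t)
          f , S , f≤   = spaces q (s≤s z≤n)
          kq≡          = trans (*-suc k (k ! * t)) (cong (λ x → k + x) (sym (*-assoc k (k !) t)))
          n≤kq         = begin
            n          ≤⟨ n≤N*[1+n/N] n N ⟩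
            N * t      ≤⟨ m≤n+m (N * t) k ⟩
            k + N * t  ≡⟨ kq≡ ⟨
            k * q      ∎
          kq≤n+B       = begin
            k * q        ≡⟨ kq≡ ⟩
            k + N * t    ≤⟨ +-monoʳ-≤ k (N*[1+n/N]≤n+N n N) ⟩
            k + (n + N)  ≡⟨ swap k n N ⟩
            n + (k + N)  ∎
      in q * q + k * f , recursive-space (small∣k! t) n≤kq S
         , recursion-bound κ {2 ^ d} {A} f≤ kq≤n+B 1≤n
    where
    open ≤-Reasoning
    k = 2 + κ
    K = k * (1 + κ)
    N = k * k !

    swap : ∀ a b c → a + (b + c) ≡ b + (a + c)
    swap = solve-∀

    instance
      N≢0 : NonZero N
      N≢0 = m*n≢0 k (k !) {{_}} {{k !≢0}}

  -- Passage to the limit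

  -- The excess of m K over n (n - 1) is at most (K/D) n² + O(n). Here `QK<D` controls the quadratic
  -- part and `large` the linear part.
  excess-bound : ∀ {Q K A D m} n → Q * K < D → Q * A + Q * D + D < suc n →
                 D * K * m ≤ (D + K) * (suc n * suc n) + A * suc n →
                 (m * K ∸ suc n * n) * Q < suc n * n
  excess-bound {Q} {K} {A} {D} {m} n′ QK<D large m-bound =
    -- Multiplying by D clears the fraction, and adding D n turns D n (n - 1) into D n².
    *-cancelˡ-< D _ _ (+-cancelʳ-< (D * n) _ _ (begin-strict
      D * ((m * K ∸ n * n′) * Q) + D * n  ≡⟨ cong (_+ D * n) (sym (*-assoc D (m * K ∸ n * n′) Q)) ⟩
      D * (m * K ∸ n * n′) * Q + D * n    ≤⟨ +-monoˡ-≤ (D * n) (*-monoˡ-≤ Q D*excess≤) ⟩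
      (K * (n * n) + (A + D) * n) * Q + D * n  ≡⟨ collect K n A D Q ⟩
      Q * K * (n * n) + (Q * A + Q * D + D) * n  <⟨ +-monoʳ-< (Q * K * (n * n)) (*-monoˡ-< n large) ⟩
      Q * K * (n * n) + n * n             ≡⟨ +-comm (Q * K * (n * n)) (n * n) ⟩
      suc (Q * K) * (n * n)               ≤⟨ *-monoˡ-≤ (n * n) QK<D ⟩
      D * (n * n)                         ≡⟨ split D n′ ⟩
      D * (n * n′) + D * n                ∎))
    where
    open ≤-Reasoning
    n = suc n′

    collect : ∀ K n A D Q → (K * (n * n) + (A + D) * n) * Q + D * n ≡
                            Q * K * (n * n) + (Q * A + Q * D + D) * n
    collect = solve-∀

    split : ∀ D n′ → D * (suc n′ * suc n′) ≡ D * (suc n′ * n′) + D * suc n′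
    split = solve-∀

    rearrange : ∀ D K A n′ → (D + K) * (suc n′ * suc n′) + A * suc n′ ≡
      D * (suc n′ * n′) + (K * (suc n′ * suc n′) + (A + D) * suc n′)
    rearrange = solve-∀

    reorder : ∀ D m K → D * (m * K) ≡ D * K * m
    reorder = solve-∀

    D*excess≤ : D * (m * K ∸ n * n′) ≤ K * (n * n) + (A + D) * n
    D*excess≤ = begin
      D * (m * K ∸ n * n′)        ≡⟨ *-distribˡ-∸ D (m * K) (n * n′) ⟩
      D * (m * K) ∸ D * (n * n′)  ≤⟨ m≤n+o⇒m∸n≤o _ (D * (n * n′)) (begin
        D * (m * K)                  ≡⟨ reorder D m K ⟩
        D * K * m                    ≤⟨ m-bound ⟩
        (D + K) * (n * n) + A * n    ≡⟨ rearrange D K A n′ ⟩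
        D * (n * n′) + (K * (n * n) + (A + D) * n) ∎) ⟩
      K * (n * n) + (A + D) * n   ∎

  sparse-bound : ∀ k (2≤k : 2 ≤ k) Q → ∃[ N ] ∀ n → N ≤ n →
                 (m̅ (suc n) k 2≤k * (k * (k ∸ 1)) ∸ suc n * n) * Q < suc n * n
  sparse-bound (suc (suc κ)) 2≤k@(s≤s (s≤s z≤n)) Q = threshold , λ n threshold≤n →
    let f , S , f≤ = spaces (suc n) (s≤s z≤n)
        m≤         = ≤-trans (*-monoʳ-≤ (D * K) (m̅≤f S 2≤k)) f≤
    in excess-bound {Q} {K} {A} {D} n (n<2^n (Q * K)) (s≤s threshold≤n) m≤
    where
    K         = (2 + κ) * (1 + κ)
    -- Q K rounds suffice, since 2 to the power Q K exceeds Q K.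
    D         = 2 ^ (Q * K)
    A         = proj₁ (sparse-spaces κ (Q * K))
    spaces    = proj₂ (sparse-spaces κ (Q * K))
    threshold = Q * A + Q * D + D

  -- The lower bound makes the difference nonnegative, so its absolute value is e / (d + 1) with the
  -- truncated difference e. A positive ε is at least 1 over its denominator, which is the tolerance
  -- used.
  near-one : ∀ m K d (ε : ℚ.ℚ) → ℚ.0ℚ ℚ.< ε → suc d ≤ m * K →
             (m * K ∸ suc d) * ℚ.↧ₙ ε < suc d →
             ℚ.∣ (+ m ℚ./ 1) ℚ.* (+ K ℚ./ suc d) ℚ.- ℚ.1ℚ ∣ ℚ.< ε
  near-one m K d ε@(ℚ.mkℚ (+ suc a) b _) _ d<mK small = ℚ.toℚᵘ-cancel-< (begin-strict
    ℚ.toℚᵘ ℚ.∣ x ℚ.* y ℚ.- ℚ.1ℚ ∣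
      ≃⟨ ℚ.toℚᵘ-homo-∣-∣ (x ℚ.* y ℚ.- ℚ.1ℚ) ⟩
    ℚᵘ.∣ ℚ.toℚᵘ (x ℚ.* y ℚ.- ℚ.1ℚ) ∣
      ≃⟨ ℚᵘ.∣-∣-cong (ℚ.toℚᵘ-homo-+ (x ℚ.* y) (ℚ.- ℚ.1ℚ)) ⟩
    ℚᵘ.∣ ℚ.toℚᵘ (x ℚ.* y) ℚᵘ.- ℚᵘ.1ℚᵘ ∣
      ≃⟨ ℚᵘ.∣-∣-cong (ℚᵘ.+-congˡ (ℚᵘ.- ℚᵘ.1ℚᵘ) xy≃) ⟩
    ℚᵘ.∣ ℚᵘ.mkℚᵘ (+ (m * K)) d ℚᵘ.- ℚᵘ.1ℚᵘ ∣
      ≃⟨ ℚᵘ.∣-∣-cong diff≃ ⟩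
    ℚᵘ.mkℚᵘ (+ e) d
      <⟨ ℚᵘ.*<* (subst₂ ℤ._<_ (ℤ.pos-* e (suc b)) (ℤ.pos-* (suc a) (suc d)) (+<+ e-small)) ⟩
    ℚ.toℚᵘ ε
      ∎)
    where
    open ℚᵘ.≤-Reasoning
    x = + m ℚ./ 1
    y = + K ℚ./ suc d
    e = m * K ∸ suc d

    e-small : e * suc b < suc a * suc d
    e-small = <-≤-trans small (m≤n*m (suc d) (suc a))

    xy≃ : ℚ.toℚᵘ (x ℚ.* y) ℚᵘ.≃ ℚᵘ.mkℚᵘ (+ (m * K)) d
    xy≃ = ℚᵘ.≃-trans (ℚ.toℚᵘ-homo-* x y) (ℚᵘ.≃-trans
      (ℚᵘ.*-cong (ℚ.toℚᵘ-fromℚᵘ (ℚᵘ.mkℚᵘ (+ m) 0)) (ℚ.toℚᵘ-fromℚᵘ (ℚᵘ.mkℚᵘ (+ K) d)))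
      (ℚᵘ.*≡* (cong₂ ℤ._*_ (sym (ℤ.pos-* m K)) (cong +_ (sym (*-identityˡ (suc d)))))))

    numerator : + (m * K) ℤ.* + 1 ℤ.+ ℤ.- + 1 ℤ.* + suc d ≡ + e
    numerator = trans
      (cong₂ ℤ._+_ (ℤ.*-identityʳ (+ (m * K))) (ℤ.-1*i≡-i (+ suc d)))
      (trans (ℤ.m-n≡m⊖n (m * K) (suc d)) (ℤ.⊖-≥ d<mK))

    diff≃ : ℚᵘ.mkℚᵘ (+ (m * K)) d ℚᵘ.- ℚᵘ.1ℚᵘ ℚᵘ.≃ ℚᵘ.mkℚᵘ (+ e) d
    diff≃ = ℚᵘ.*≡* (cong₂ ℤ._*_ numerator (cong +_ (sym (*-identityʳ (suc d)))))
  near-one m K d (ℚ.mkℚ (+ 0) b _) (ℚ.*<* (+<+ ()))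
  near-one m K d (ℚ.mkℚ ℤ.-[1+ _ ] b _) (ℚ.*<* ())

open import Data.Nat using (ℕ; _≤_; _∸_) renaming (_+_ to _+ℕ_; _*_ to _*ℕ_)
open import Data.Integer using (+_)
open import Data.Rational using (1ℚ; _*_; _/_)

open import Data.Nat.Properties using (m≤n⇒m≤1+n)
open import Data.Product.Base using (_,_; proj₁; proj₂)
open import Data.Rational.Base using (↧ₙ_)
open LinearSpaces using (lowerBound; sparse-bound; near-one)

theorem8 : ∀ (k : ℕ) (2≤k : 2 ≤ k) →
    (λ i → let n = 2 +ℕ i in
    (+ m̅ n k 2≤k / 1) * (+ (k *ℕ (k ∸ 1)) / (n *ℕ (n ∸ 1)))) ⟶ 1ℚ
theorem8 k 2≤k ε 0<ε = proj₁ sparse , λ i N≤i →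
  -- For n = 2 + i the product n (n - 1) is visibly a successor, which determines the omitted
  -- argument. `sparse-bound` speaks of `suc n` vertices, hence the index `1 + i`.
  near-one (m̅ (2 +ℕ i) k 2≤k) (k *ℕ (k ∸ 1)) _ ε 0<ε
    (lowerBound (2 +ℕ i) k 2≤k) (proj₂ sparse (1 +ℕ i) (m≤n⇒m≤1+n N≤i))
  where
  sparse = sparse-bound k 2≤k (↧ₙ ε)
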